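{- (Canonicity for $\lambda^{\textsc{prk}}$.) 1. If $\vdash t:P$ (in the empty typing context), then $t$ reduces (in zero or more steps) to a canonical term. 2. If $\Gamma\vdash t:P$ where $\Gamma$ is a classical typing context and $P$ is strong, then either $t\to^*t'$ with $t'$ canonical, or $t\to^*\mathtt{K}\langle t'\rangle$ where $\mathtt{K}$ is a case-context and $t'$ is an open explosion. 3. If $\Gamma\vdash t:P$ where $\Gamma$ is a classical typing context and $P$ is classical, then either $t\to^*\mathsf{IC}^\pm_x.t'$ for some sign $\pm\in\{+,-\}$, variable $x$ and term $t'$, or $t\to^*\mathtt{E}\langle t'\rangle$ where $\mathtt{E}$ is an eliminative context and $t'$ is a variable or an open explosion.
   Context: **Types.** Fix a denumerable set of propositional variables $\alpha$. Pure propositions: $A,B ::= \alpha \mid A\land B\mid A\lor B\mid \neg A$. Types (moded propositions): $P,Q ::= A^+\mid A^-\mid A^\oplus\mid A^\ominus$; $A^+,A^-$ are strong, $A^\oplus,A^\ominus$ classical. Opposite: $(A^+)^\sim=A^-$, $(A^-)^\sim=A^+$, $(A^\oplus)^\sim=A^\ominus$, $(A^\ominus)^\sim=A^\oplus$. **Terms of $\lambda^{\textsc{prk}}$.** ($i\in\{1,2\}$, $\pm\in\{+,-\}$; $x,y$ from a denumerable set of variables) $$t,s,u ::= x \mid t\blacktriangleright\!\blacktriangleleft_P s\mid \langle t,s\rangle^\pm\mid \pi_i^\pm(t)\mid \mathsf{in}_i^\pm(t)\mid \delta^\pm t[_{x:P}.s][_{y:Q}.u]\mid \nu^\pm t\mid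 \mu^\pm t\mid \mathsf{IC}^\pm_{(x:P)}.t\mid t\bullet^\pm s.$$ In $\delta^\pm t[_{x:P}.s][_{y:Q}.u]$, $x$ is bound in $s$ and $y$ in $u$; in $\mathsf{IC}^\pm_{(x:P)}.t$, $x$ is bound in $t$. Terms are taken modulo $\alpha$-renaming; $t[x:=s]$ is capture-avoiding substitution. Type annotations may be omitted. **Typing.** Typing contexts $\Gamma$ are finite lists $x_1:P_1,\dots,x_n:P_n$ with distinct variables, up to reordering. Rules: - (Ax) $\Gamma,x:P\vdash x:P$. (Abs) $\Gamma\vdash t:P$, $\Gamma\vdash s:P^\sim$, $P$ strong $\Rightarrow$ $\Gamma\vdash t\blacktriangleright\!\blacktriangleleft_Q s:Q$. - $\Gamma\vdash t:A^\oplus$, $\Gamma\vdash s:B^\oplus$ $\Rightarrow$ $\Gamma\vdash\langle t,s\rangle^+:(A\land B)^+$. $\Gamma\vdash t:A^\ominus$, $\Gamma\vdash s:B^\ominus$ $\Rightarrow$ $\Gamma\vdash\langle t,s\rangle^-:(A\lor B)^-$. - $\Gamma\vdash t:(A_1\land A_2)^+$ $\Rightarrow$ $\Gamma\vdash\pi^+_i(t):A_i^\oplus$. $\Gamma\vdash t:(A_1\lor A_2)^-$ $\Rightarrow$ $\Gamma\vdash\pi^-_i(t):A_i^\ominus$. - $\Gamma\vdash t:A_i^\oplus$ $\Rightarrow$ $\Gamma\vdash\mathsf{in}^+_i(t):(A_1\lor A_2)^+$. $\Gamma\vdash t:A_i^\ominus$ $\Rightarrow$ $\Gamma\vdash\mathsf{in}^-_i(t):(A_1\land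 A_2)^-$. - $\Gamma\vdash t:(A\lor B)^+$, $\Gamma,x:A^\oplus\vdash s:P$, $\Gamma,y:B^\oplus\vdash u:P$ $\Rightarrow$ $\Gamma\vdash\delta^+t[_{x:A^\oplus}.s][_{y:B^\oplus}.u]:P$. $\Gamma\vdash t:(A\land B)^-$, $\Gamma,x:A^\ominus\vdash s:P$, $\Gamma,y:B^\ominus\vdash u:P$ $\Rightarrow$ $\Gamma\vdash\delta^-t[_{x:A^\ominus}.s][_{y:B^\ominus}.u]:P$. - $\Gamma\vdash t:A^\ominus$ $\Rightarrow$ $\Gamma\vdash\nu^+t:(\neg A)^+$. $\Gamma\vdash t:A^\oplus$ $\Rightarrow$ $\Gamma\vdash\nu^-t:(\neg A)^-$. $\Gamma\vdash t:(\neg A)^+$ $\Rightarrow$ $\Gamma\vdash\mu^+t:A^\ominus$. $\Gamma\vdash t:(\neg A)^-$ $\Rightarrow$ $\Gamma\vdash\mu^-t:A^\oplus$. - $\Gamma,x:A^\ominus\vdash t:A^+$ $\Rightarrow$ $\Gamma\vdash\mathsf{IC}^+_{(x:A^\ominus)}.t:A^\oplus$. $\Gamma,x:A^\oplus\vdash t:A^-$ $\Rightarrow$ $\Gamma\vdash\mathsf{IC}^-_{(x:A^\oplus)}.t:A^\ominus$. - $\Gamma\vdash t:A^\oplus$, $\Gamma\vdash s:A^\ominus$ $\Rightarrow$ $\Gamma\vdash t\bullet^+s:A^+$. $\Gamma\vdash t:A^\ominus$, $\Gamma\vdash s:A^\oplus$ $\Rightarrow$ $\Gamma\vdash t\bullet^-s:A^-$.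 **Generalized absurdity.** For $t:P$ and $s:P^\sim$, $t\bowtie_Q s$ denotes: $t\blacktriangleright\!\blacktriangleleft_Q s$ if $P$ is strong; $(t\bullet^+s)\blacktriangleright\!\blacktriangleleft_Q(s\bullet^-t)$ if $P=A^\oplus$; $(t\bullet^-s)\blacktriangleright\!\blacktriangleleft_Q(s\bullet^+t)$ if $P=A^\ominus$. **Reduction.** $\to$ is defined on typable terms as the closure under arbitrary contexts of the following rules (in each rule all $\pm$ denote the same sign, $\mp$ the opposite sign, and $i\in\{1,2\}$); $\to^*$ is its reflexive-transitive closure: - $\pi_i^\pm(\langle t_1,t_2\rangle^\pm)\to t_i$; - $\delta^\pm(\mathsf{in}_i^\pm(t))[_x.s_1][_x.s_2]\to s_i[x:=t]$; - $\mu^\pm(\nu^\pm t)\to t$; - $(\mathsf{IC}^\pm_x.t)\bullet^\pm s\to t[x:=s]$; - $\langle t_1,t_2\rangle^\pm\blacktriangleright\!\blacktriangleleft_Q\mathsf{in}_i^\mp(s)\to t_i\bowtie_Q s$; - $\mathsf{in}_i^\pm(t)\blacktriangleright\!\blacktriangleleft_Q\langle s_1,s_2\rangle^\mp\to t\bowtie_Q s_i$; - $(\nu^\pm t)\blacktriangleright\!\blacktriangleleft_Q(\nu^\mp s)\to t\bowtie_Q s$. **Nomenclature.** A term is *canonical* if it has one of the shapes $\langle t_1,t_2\rangle^\pm$, $\mathsf{in}_i^\pm(t)$, $\nu^\pm t$, $\mathsf{IC}^\pm_x.t$. A typing context is *classical* if all its assumptions have types of the form $A^\oplus$ or $A^\ominus$.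 A *case-context* is $\mathtt{K} ::= \Box\mid\delta^\pm\mathtt{K}[_x.t][_y.s]$. An *eliminative context* is $\mathtt{E} ::= \Box\mid\pi_i^\pm(\mathtt{E})\mid\delta^\pm\mathtt{E}[_x.t][_y.s]\mid\mu^\pm\mathtt{E}$. $\mathtt{K}\langle t\rangle$, $\mathtt{E}\langle t\rangle$ denote replacing the hole $\Box$ by $t$. An *explosion* is a term of the form $t\blacktriangleright\!\blacktriangleleft_P s$ or $t\bullet^\pm s$. A term is *open* if it has at least one free variable. -}

module Defs where

open import Data.Fin.Base using (Fin; zero; suc)
open import Data.Fin.Substitution using (Sub; Lift; TermSubst)
open import Data.Nat.Base using (ℕ; suc)
open import Data.Product.Base using (∃-syntax)
open import Data.Sign.Base using (Sign; +; -; opposite)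
open import Data.Sum.Base using (_⊎_)
open import Data.Vec.Base using (Vec; _∷_; lookup; _[_]=_)
open import Data.Vec.Relation.Unary.All using (All)
open import Relation.Binary.Construct.Closure.ReflexiveTransitive using (Star)
open import Relation.Binary.PropositionalEquality.Core using (_≡_)

------------------------------------------------------------------------
-- Types

infixr 7 _∧_
infixr 6 _∨_
infix  8 ¬_

data Pure : Set where
  atom : ℕ → Pure
  _∧_  : Pure → Pure → Pure
  _∨_  : Pure → Pure → Pure
  ¬_   : Pure → Pure

data Mode : Set where
  strong classical : Sign → Mode

infix 5 _^_ _⁺ _⁻ _⊕ _⊖

data Type : Set where
  _^_ : Pure → Mode → Type

pattern _⁺ A = A ^ strong +
pattern _⁻ A = A ^ strong -
pattern _⊕ A = A ^ classical +
pattern _⊖ A = A ^ classical -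

infix 9 _~

_~ : Type → Type
(A ^ strong σ)    ~ = A ^ strong (opposite σ)
(A ^ classical σ) ~ = A ^ classical (opposite σ)

data StrongType : Type → Set where
  strong : ∀ {A} σ → StrongType (A ^ strong σ)

data ClassicalType : Type → Set where
  classical : ∀ {A} σ → ClassicalType (A ^ classical σ)

------------------------------------------------------------------------
-- Terms

-- Terms modulo α-renaming are represented by well-scoped de Bruijn terms:
-- Term n is the set of terms whose free variables are among n given ones.
-- The indices i ∈ {1,2} are zero and suc zero in Fin 2.

infix 6 _▶◀[_]_ _•[_]_

data Term (n : ℕ) : Set where
  var     : Fin n → Term n
  _▶◀[_]_ : Term n → Type → Term n → Term n
  pair    : Sign → Term n → Term n → Term n
  π       : Sign → Fin 2 → Term n → Term n
  inj     : Sign → Fin 2 → Term n → Term n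
  -- δ σ t P s Q u is δ^σ t [x:P. s] [y:Q. u].
  δ       : Sign → Term n → Type → Term (suc n) → Type → Term (suc n) → Term n
  ν       : Sign → Term n → Term n
  μ       : Sign → Term n → Term n
  IC      : Sign → Type → Term (suc n) → Term n
  _•[_]_  : Term n → Sign → Term n → Term n

pick : ∀ {a} {A : Set a} → Fin 2 → A → A → A
pick zero       a₁ a₂ = a₁
pick (suc zero) a₁ a₂ = a₂

------------------------------------------------------------------------
-- Substitution

module _ {T : ℕ → Set} (l : Lift T Term) where
  open Lift l using (lift; _↑)

  apply : ∀ {m n} → Term m → Sub T m n → Term n
  apply (var x)         ρ = lift (lookup ρ x)
  apply (t ▶◀[ P ] s)   ρ = apply t ρ ▶◀[ P ] apply s ρ
  apply (pair σ t s)    ρ = pair σ (apply t ρ) (apply s ρ)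
  apply (π σ i t)       ρ = π σ i (apply t ρ)
  apply (inj σ i t)     ρ = inj σ i (apply t ρ)
  apply (δ σ t P s Q u) ρ = δ σ (apply t ρ) P (apply s (ρ ↑)) Q (apply u (ρ ↑))
  apply (ν σ t)         ρ = ν σ (apply t ρ)
  apply (μ σ t)         ρ = μ σ (apply t ρ)
  apply (IC σ P t)      ρ = IC σ P (apply t (ρ ↑))
  apply (t •[ σ ] s)    ρ = apply t ρ •[ σ ] apply s ρ

termSubst : TermSubst Term
termSubst = record { var = var ; app = apply }

open TermSubst termSubst public using (_/_; sub)

infix 8 _[_]

_[_] : ∀ {n} → Term (suc n) → Term n → Term n
t [ s ] = t / sub s

------------------------------------------------------------------------
-- Typing

Context : ℕ → Set
Context n = Vec Type n

infix 4 _⊢_∶_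

data _⊢_∶_ {n} (Γ : Context n) : Term n → Type → Set where

  ax   : ∀ {x P} → Γ [ x ]= P → Γ ⊢ var x ∶ P

  abs  : ∀ {t s P Q} → StrongType P → Γ ⊢ t ∶ P → Γ ⊢ s ∶ P ~ →
         Γ ⊢ t ▶◀[ Q ] s ∶ Q

  I∧⁺  : ∀ {t s A B} → Γ ⊢ t ∶ A ⊕ → Γ ⊢ s ∶ B ⊕ → Γ ⊢ pair + t s ∶ A ∧ B ⁺
  I∨⁻  : ∀ {t s A B} → Γ ⊢ t ∶ A ⊖ → Γ ⊢ s ∶ B ⊖ → Γ ⊢ pair - t s ∶ A ∨ B ⁻

  E∧⁺  : ∀ {t A₁ A₂} i → Γ ⊢ t ∶ A₁ ∧ A₂ ⁺ → Γ ⊢ π + i t ∶ pick i A₁ A₂ ⊕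
  E∨⁻  : ∀ {t A₁ A₂} i → Γ ⊢ t ∶ A₁ ∨ A₂ ⁻ → Γ ⊢ π - i t ∶ pick i A₁ A₂ ⊖

  I∨⁺  : ∀ {t A₁ A₂} i → Γ ⊢ t ∶ pick i A₁ A₂ ⊕ → Γ ⊢ inj + i t ∶ A₁ ∨ A₂ ⁺
  I∧⁻  : ∀ {t A₁ A₂} i → Γ ⊢ t ∶ pick i A₁ A₂ ⊖ → Γ ⊢ inj - i t ∶ A₁ ∧ A₂ ⁻

  E∨⁺  : ∀ {t s u A B P} → Γ ⊢ t ∶ A ∨ B ⁺ →
         (A ⊕) ∷ Γ ⊢ s ∶ P → (B ⊕) ∷ Γ ⊢ u ∶ P →
         Γ ⊢ δ + t (A ⊕) s (B ⊕) u ∶ P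
  E∧⁻  : ∀ {t s u A B P} → Γ ⊢ t ∶ A ∧ B ⁻ →
         (A ⊖) ∷ Γ ⊢ s ∶ P → (B ⊖) ∷ Γ ⊢ u ∶ P →
         Γ ⊢ δ - t (A ⊖) s (B ⊖) u ∶ P

  I¬⁺  : ∀ {t A} → Γ ⊢ t ∶ A ⊖ → Γ ⊢ ν + t ∶ ¬ A ⁺
  I¬⁻  : ∀ {t A} → Γ ⊢ t ∶ A ⊕ → Γ ⊢ ν - t ∶ ¬ A ⁻
  E¬⁺  : ∀ {t A} → Γ ⊢ t ∶ ¬ A ⁺ → Γ ⊢ μ + t ∶ A ⊖
  E¬⁻  : ∀ {t A} → Γ ⊢ t ∶ ¬ A ⁻ → Γ ⊢ μ - t ∶ A ⊕

  IC⁺  : ∀ {t A} → (A ⊖) ∷ Γ ⊢ t ∶ A ⁺ → Γ ⊢ IC + (A ⊖) t ∶ A ⊕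
  IC⁻  : ∀ {t A} → (A ⊕) ∷ Γ ⊢ t ∶ A ⁻ → Γ ⊢ IC - (A ⊕) t ∶ A ⊖

  EC⁺  : ∀ {t s A} → Γ ⊢ t ∶ A ⊕ → Γ ⊢ s ∶ A ⊖ → Γ ⊢ t •[ + ] s ∶ A ⁺
  EC⁻  : ∀ {t s A} → Γ ⊢ t ∶ A ⊖ → Γ ⊢ s ∶ A ⊕ → Γ ⊢ t •[ - ] s ∶ A ⁻

------------------------------------------------------------------------
-- Reduction

-- Generalized absurdity of t : P and s : P ~. It depends on P only
-- through the mode of P, which is the first argument in the brackets.

infix 6 _⋈[_,_]_

_⋈[_,_]_ : ∀ {n} → Term n → Mode → Type → Term n → Term n
t ⋈[ strong σ    , Q ] s = t ▶◀[ Q ] s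
t ⋈[ classical σ , Q ] s = (t •[ σ ] s) ▶◀[ Q ] (s •[ opposite σ ] t)

-- The relation is given on all terms and is meant to be applied to
-- typable ones. In the last three β-rules, typability of the redex
-- forces the mode at which ⋈ is used: t has a type A^⊕ or A^⊖, of sign σ
-- if t occurs in pair σ or inj σ, and of sign opposite σ if t occurs in ν σ.

infix 4 _⟶_ _⟶*_

data _⟶_ {n} : Term n → Term n → Set where

  β-π   : ∀ {σ i t₁ t₂} → π σ i (pair σ t₁ t₂) ⟶ pick i t₁ t₂
  β-δ   : ∀ {σ i t P s₁ Q s₂} →
          δ σ (inj σ i t) P s₁ Q s₂ ⟶ pick i s₁ s₂ [ t ]
  β-μ   : ∀ {σ t} → μ σ (ν σ t) ⟶ t
  β-•   : ∀ {σ P t s} → IC σ P t •[ σ ] s ⟶ t [ s ]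

  β-pair-inj : ∀ {σ i t₁ t₂ Q s} →
    pair σ t₁ t₂ ▶◀[ Q ] inj (opposite σ) i s ⟶
    pick i t₁ t₂ ⋈[ classical σ , Q ] s
  β-inj-pair : ∀ {σ i t Q s₁ s₂} →
    inj σ i t ▶◀[ Q ] pair (opposite σ) s₁ s₂ ⟶
    t ⋈[ classical σ , Q ] pick i s₁ s₂
  β-ν-ν      : ∀ {σ t Q s} →
    ν σ t ▶◀[ Q ] ν (opposite σ) s ⟶
    t ⋈[ classical (opposite σ) , Q ] s

  ξ-▶◀₁   : ∀ {t t′ Q s} → t ⟶ t′ → t ▶◀[ Q ] s ⟶ t′ ▶◀[ Q ] s
  ξ-▶◀₂   : ∀ {t Q s s′} → s ⟶ s′ → t ▶◀[ Q ] s ⟶ t ▶◀[ Q ] s′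
  ξ-pair₁ : ∀ {σ t t′ s} → t ⟶ t′ → pair σ t s ⟶ pair σ t′ s
  ξ-pair₂ : ∀ {σ t s s′} → s ⟶ s′ → pair σ t s ⟶ pair σ t s′
  ξ-π     : ∀ {σ i t t′} → t ⟶ t′ → π σ i t ⟶ π σ i t′
  ξ-inj   : ∀ {σ i t t′} → t ⟶ t′ → inj σ i t ⟶ inj σ i t′
  ξ-δ₀    : ∀ {σ t t′ P s Q u} → t ⟶ t′ → δ σ t P s Q u ⟶ δ σ t′ P s Q u
  ξ-δ₁    : ∀ {σ t P s s′ Q u} → s ⟶ s′ → δ σ t P s Q u ⟶ δ σ t P s′ Q u
  ξ-δ₂    : ∀ {σ t P s Q u u′} → u ⟶ u′ → δ σ t P s Q u ⟶ δ σ t P s Q u′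
  ξ-ν     : ∀ {σ t t′} → t ⟶ t′ → ν σ t ⟶ ν σ t′
  ξ-μ     : ∀ {σ t t′} → t ⟶ t′ → μ σ t ⟶ μ σ t′
  ξ-IC    : ∀ {σ P t t′} → t ⟶ t′ → IC σ P t ⟶ IC σ P t′
  ξ-•₁    : ∀ {σ t t′ s} → t ⟶ t′ → t •[ σ ] s ⟶ t′ •[ σ ] s
  ξ-•₂    : ∀ {σ t s s′} → s ⟶ s′ → t •[ σ ] s ⟶ t •[ σ ] s′

_⟶*_ : ∀ {n} → Term n → Term n → Set
_⟶*_ = Star _⟶_

------------------------------------------------------------------------
-- Nomenclature

data Canonical {n} : Term n → Set where
  pair : ∀ σ t s → Canonical (pair σ t s)
  inj  : ∀ σ i t → Canonical (inj σ i t)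
  ν    : ∀ σ t   → Canonical (ν σ t)
  IC   : ∀ σ P t → Canonical (IC σ P t)

ClassicalContext : ∀ {n} → Context n → Set
ClassicalContext = All ClassicalType

-- The hole of a case-context or an eliminative context is never under a
-- binder, so such a context and the term plugged into it have one scope.

data CaseContext (n : ℕ) : Set where
  □ : CaseContext n
  δ : Sign → CaseContext n → Type → Term (suc n) → Type → Term (suc n) →
      CaseContext n

data ElimContext (n : ℕ) : Set where
  □ : ElimContext n
  π : Sign → Fin 2 → ElimContext n → ElimContext n
  δ : Sign → ElimContext n → Type → Term (suc n) → Type → Term (suc n) →
      ElimContext n
  μ : Sign → ElimContext n → ElimContext n

infix 9 _K⟨_⟩ _E⟨_⟩

_K⟨_⟩ : ∀ {n} → CaseContext n → Term n → Term n
□             K⟨ r ⟩ = r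
δ σ K P s Q u K⟨ r ⟩ = δ σ (K K⟨ r ⟩) P s Q u

_E⟨_⟩ : ∀ {n} → ElimContext n → Term n → Term n
□             E⟨ r ⟩ = r
π σ i E       E⟨ r ⟩ = π σ i (E E⟨ r ⟩)
δ σ E P s Q u E⟨ r ⟩ = δ σ (E E⟨ r ⟩) P s Q u
μ σ E         E⟨ r ⟩ = μ σ (E E⟨ r ⟩)

data Variable {n} : Term n → Set where
  var : ∀ x → Variable (var x)

data Explosion {n} : Term n → Set where
  absurdity   : ∀ t P s → Explosion (t ▶◀[ P ] s)
  application : ∀ t σ s → Explosion (t •[ σ ] s)

infix 4 _∈FV_

_∈FV_ : ∀ {n} → Fin n → Term n → Set
x ∈FV var y         = x ≡ y
x ∈FV t ▶◀[ P ] s   = x ∈FV t ⊎ x ∈FV s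
x ∈FV pair σ t s    = x ∈FV t ⊎ x ∈FV s
x ∈FV π σ i t       = x ∈FV t
x ∈FV inj σ i t     = x ∈FV t
x ∈FV δ σ t P s Q u = x ∈FV t ⊎ suc x ∈FV s ⊎ suc x ∈FV u
x ∈FV ν σ t         = x ∈FV t
x ∈FV μ σ t         = x ∈FV t
x ∈FV IC σ P t      = suc x ∈FV t
x ∈FV t •[ σ ] s    = x ∈FV t ⊎ x ∈FV s

Open : ∀ {n} → Term n → Set
Open t = ∃[ x ] x ∈FV t

{-# OPTIONS --safe #-}

-- Evaluating the scrutinees of π, δ and μ already suffices; neither β-• nor the
-- rules for ▶◀ are ever fired. By induction on typing derivations, every
-- substitution instance t / ρ of a typed term has an outcome of the required
-- kind, provided that the terms in ρ do. The predicate on strong types also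
-- records outcomes for the immediate subterms of the value reached; these have
-- classical types, whose outcomes do not refer to any further type, so no
-- recursion on types is involved.
--
-- An explosion has subterms of opposite types. Interpreting both A⁺ and A⊕ as
-- "A is true" and both A⁻ and A⊖ as "A is false" under a Boolean valuation is
-- sound, so no typable explosion is closed.

module Submission where

open import Defs
open import Data.Bool.Base as Bool using (Bool; true; false)
open import Data.Empty using (⊥; ⊥-elim)
open import Data.Fin.Base using (Fin; zero; suc)
open import Data.Fin.Properties using (_≟_; any?)
open import Data.Fin.Substitution using (Sub; Subs; Lift; TermSubst; module VarSubst)
open import Data.Fin.Substitution.Lemmas using (TermLemmas; module VarLemmas)
open import Data.Nat.Base using (ℕ; suc)
open import Data.Product.Base using (_×_; _,_; ∃-syntax; proj₁; proj₂)
open import Data.Sign.Base using (Sign; +; -)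
open import Data.Sum.Base using (_⊎_; inj₁; inj₂)
open import Data.Vec.Base using ([]; _∷_; map; lookup; _[_]=_; here; there)
open import Data.Vec.Properties using ([]=⇒lookup; lookup-map)
open import Data.Vec.Relation.Unary.All using ([])
open import Data.Vec.Relation.Unary.All.Properties using (lookup⁺)
open import Function.Base using (_∘_)
open import Relation.Binary.Construct.Closure.ReflexiveTransitive using (ε; _◅_; _◅◅_; gmap)
open import Relation.Binary.PropositionalEquality
  using (_≡_; refl; sym; trans; cong; cong₂; subst; module ≡-Reasoning)
open import Relation.Nullary using (Dec; yes; no)
open import Relation.Nullary.Decidable using (_⊎-dec_)

-- Substitution

module _ {T : ℕ → Set} (l : Lift T Term) where
  open TermSubst.Lifted termSubst l using (_/✶_; _↑✶_)

  ▶◀-/✶ : ∀ {m n P t s} (ρs : Subs T m n) → (t ▶◀[ P ] s) /✶ ρs ≡ t /✶ ρs ▶◀[ P ] s /✶ ρs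
  ▶◀-/✶ ε        = refl
  ▶◀-/✶ (ρ ◅ ρs) = cong (λ r → apply l r ρ) (▶◀-/✶ ρs)

  pair-/✶ : ∀ {m n σ t s} (ρs : Subs T m n) → pair σ t s /✶ ρs ≡ pair σ (t /✶ ρs) (s /✶ ρs)
  pair-/✶ ε        = refl
  pair-/✶ (ρ ◅ ρs) = cong (λ r → apply l r ρ) (pair-/✶ ρs)

  π-/✶ : ∀ {m n σ i t} (ρs : Subs T m n) → π σ i t /✶ ρs ≡ π σ i (t /✶ ρs)
  π-/✶ ε        = refl
  π-/✶ (ρ ◅ ρs) = cong (λ r → apply l r ρ) (π-/✶ ρs)

  inj-/✶ : ∀ {m n σ i t} (ρs : Subs T m n) → inj σ i t /✶ ρs ≡ inj σ i (t /✶ ρs)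
  inj-/✶ ε        = refl
  inj-/✶ (ρ ◅ ρs) = cong (λ r → apply l r ρ) (inj-/✶ ρs)

  -- Binders force the sequence to have the form `ρs ↑✶ k`: passing under one more binder then
  -- yields `ρs ↑✶ suc k` by computation. `IC-/✶` is stated in the same way.
  δ-/✶ : ∀ {m n σ} k {t P s Q u} (ρs : Subs T m n) →
         δ σ t P s Q u /✶ ρs ↑✶ k ≡
         δ σ (t /✶ ρs ↑✶ k) P (s /✶ ρs ↑✶ suc k) Q (u /✶ ρs ↑✶ suc k)
  δ-/✶ k ε        = refl
  δ-/✶ k (ρ ◅ ρs) = cong (λ r → apply l r _) (δ-/✶ k ρs)

  ν-/✶ : ∀ {m n σ t} (ρs : Subs T m n) → ν σ t /✶ ρs ≡ ν σ (t /✶ ρs)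
  ν-/✶ ε        = refl
  ν-/✶ (ρ ◅ ρs) = cong (λ r → apply l r ρ) (ν-/✶ ρs)

  μ-/✶ : ∀ {m n σ t} (ρs : Subs T m n) → μ σ t /✶ ρs ≡ μ σ (t /✶ ρs)
  μ-/✶ ε        = refl
  μ-/✶ (ρ ◅ ρs) = cong (λ r → apply l r ρ) (μ-/✶ ρs)

  IC-/✶ : ∀ {m n σ P} k {t} (ρs : Subs T m n) →
          IC σ P t /✶ ρs ↑✶ k ≡ IC σ P (t /✶ ρs ↑✶ suc k)
  IC-/✶ k ε        = refl
  IC-/✶ k (ρ ◅ ρs) = cong (λ r → apply l r _) (IC-/✶ k ρs)

  •-/✶ : ∀ {m n σ t s} (ρs : Subs T m n) → (t •[ σ ] s) /✶ ρs ≡ t /✶ ρs •[ σ ] s /✶ ρs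
  •-/✶ ε        = refl
  •-/✶ (ρ ◅ ρs) = cong (λ r → apply l r ρ) (•-/✶ ρs)

module _ {T₁ T₂ : ℕ → Set} {l₁ : Lift T₁ Term} {l₂ : Lift T₂ Term} where
  open TermSubst.Lifted termSubst l₁ using () renaming (_/✶_ to _/✶₁_; _↑✶_ to _↑✶₁_)
  open TermSubst.Lifted termSubst l₂ using () renaming (_/✶_ to _/✶₂_; _↑✶_ to _↑✶₂_)

  -- Agreement on variables is assumed at every depth `k`, since the induction on `t` increases `k`
  -- at each binder. Keeping `T₁` and `T₂` distinct allows renamings to be compared with term
  -- substitutions. The general substitution lemmas of `TermLemmas` rest on this.
  /✶-↑✶ : ∀ {m n} (ρs₁ : Subs T₁ m n) (ρs₂ : Subs T₂ m n) →
          (∀ k x → var x /✶₁ ρs₁ ↑✶₁ k ≡ var x /✶₂ ρs₂ ↑✶₂ k) →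
          ∀ k t → t /✶₁ ρs₁ ↑✶₁ k ≡ t /✶₂ ρs₂ ↑✶₂ k
  /✶-↑✶ ρs₁ ρs₂ hyp = go
    where
    via : ∀ {n} {t t′ s s′ : Term n} → t ≡ t′ → s ≡ s′ → t′ ≡ s′ → t ≡ s
    via p q r = trans p (trans r (sym q))

    go : ∀ k t → t /✶₁ ρs₁ ↑✶₁ k ≡ t /✶₂ ρs₂ ↑✶₂ k
    go k (var x)         = hyp k x
    go k (t ▶◀[ P ] s)   =
      via (▶◀-/✶ l₁ (ρs₁ ↑✶₁ k)) (▶◀-/✶ l₂ (ρs₂ ↑✶₂ k)) (cong₂ (_▶◀[ P ]_) (go k t) (go k s))
    go k (pair σ t s)    =
      via (pair-/✶ l₁ (ρs₁ ↑✶₁ k)) (pair-/✶ l₂ (ρs₂ ↑✶₂ k)) (cong₂ (pair σ) (go k t) (go k s))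
    go k (π σ i t)       =
      via (π-/✶ l₁ (ρs₁ ↑✶₁ k)) (π-/✶ l₂ (ρs₂ ↑✶₂ k)) (cong (π σ i) (go k t))
    go k (inj σ i t)     =
      via (inj-/✶ l₁ (ρs₁ ↑✶₁ k)) (inj-/✶ l₂ (ρs₂ ↑✶₂ k)) (cong (inj σ i) (go k t))
    go k (δ σ t P s Q u) =
      via (δ-/✶ l₁ k ρs₁) (δ-/✶ l₂ k ρs₂)
        (trans (cong (λ r → δ σ r P _ Q _) (go k t))
               (cong₂ (λ s u → δ σ _ P s Q u) (go (suc k) s) (go (suc k) u)))
    go k (ν σ t)         =
      via (ν-/✶ l₁ (ρs₁ ↑✶₁ k)) (ν-/✶ l₂ (ρs₂ ↑✶₂ k)) (cong (ν σ) (go k t))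
    go k (μ σ t)         =
      via (μ-/✶ l₁ (ρs₁ ↑✶₁ k)) (μ-/✶ l₂ (ρs₂ ↑✶₂ k)) (cong (μ σ) (go k t))
    go k (IC σ P t)      =
      via (IC-/✶ l₁ k ρs₁) (IC-/✶ l₂ k ρs₂) (cong (IC σ P) (go (suc k) t))
    go k (t •[ σ ] s)    =
      via (•-/✶ l₁ (ρs₁ ↑✶₁ k)) (•-/✶ l₂ (ρs₂ ↑✶₂ k)) (cong₂ (_•[ σ ]_) (go k t) (go k s))

termLemmas : TermLemmas Term
termLemmas = record { termSubst = termSubst; app-var = refl; /✶-↑✶ = /✶-↑✶ }

open TermLemmas termLemmas
  using (id; _↑; _⊙_; /-⊙; id-vanishes; lookup-id; map-weaken-⊙-sub)

-- Bridges two forms of a branch of `δ`: contracting `β-δ` in an instance gives the left-hand side,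
-- whereas the induction on typing speaks of the right-hand side.
/-↑-sub : ∀ {m n} (s : Term (suc m)) (ρ : Sub Term m n) t → (s / ρ ↑) [ t ] ≡ s / (t ∷ ρ)
/-↑-sub s ρ t = begin
  (s / ρ ↑) [ t ]              ≡⟨ sym (/-⊙ s) ⟩
  s / (ρ ↑ ⊙ sub t)            ≡⟨⟩
  -- The head of `ρ ↑` is `var zero`, which `sub t` sends to `t`. The tail is `ρ` weakened, and
  -- `sub t` undoes the weakening.
  s / (t ∷ map _ ρ ⊙ sub t)    ≡⟨ cong (λ ρ′ → s / (t ∷ ρ′)) map-weaken-⊙-sub ⟩
  s / (t ∷ ρ)                  ∎
  where open ≡-Reasoning

-- Typing of substitution instances

-- Covers renamings and term substitutions at once, so that `⊢apply` is proved only once. The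
-- instance for renamings comes first, because it supplies the weakening of typings that the
-- instance for terms requires.
record TypedLift {T : ℕ → Set} (l : Lift T Term) : Set₁ where
  open Lift l using (lift; weaken) renaming (var to varT)
  infix 4 _⊢ₜ_∶_
  field
    _⊢ₜ_∶_    : ∀ {n} → Context n → T n → Type → Set
    ⊢var-zero : ∀ {n} {Γ : Context n} {P} → P ∷ Γ ⊢ₜ varT zero ∶ P
    ⊢weaken   : ∀ {n} {Γ : Context n} {t P Q} → Γ ⊢ₜ t ∶ P → Q ∷ Γ ⊢ₜ weaken t ∶ P
    ⊢lift     : ∀ {n} {Γ : Context n} {t P} → Γ ⊢ₜ t ∶ P → Γ ⊢ lift t ∶ P

module _ {T : ℕ → Set} {l : Lift T Term} (tl : TypedLift l) where
  open Lift l using (weaken) renaming (_↑ to _↑ₜ)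
  open TypedLift tl

  TypedSub : ∀ {m n} → Context m → Context n → Sub T m n → Set
  TypedSub Γ Δ ρ = ∀ {x P} → Γ [ x ]= P → Δ ⊢ₜ lookup ρ x ∶ P

  ⊢↑ : ∀ {m n Q} {Γ : Context m} {Δ : Context n} (ρ : Sub T m n) →
       TypedSub Γ Δ ρ → TypedSub (Q ∷ Γ) (Q ∷ Δ) (ρ ↑ₜ)
  ⊢↑ ρ ⊢ρ here               = ⊢var-zero
  ⊢↑ ρ ⊢ρ (there {i = x} x∈) =
    subst (_ ⊢ₜ_∶ _) (sym (lookup-map x weaken ρ)) (⊢weaken (⊢ρ x∈))

  ⊢apply : ∀ {m n t P} {Γ : Context m} {Δ : Context n} {ρ : Sub T m n} →
           TypedSub Γ Δ ρ → Γ ⊢ t ∶ P → Δ ⊢ apply l t ρ ∶ P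
  ⊢apply ⊢ρ (ax x∈)         = ⊢lift (⊢ρ x∈)
  ⊢apply ⊢ρ (abs st ⊢t ⊢s)  = abs st (⊢apply ⊢ρ ⊢t) (⊢apply ⊢ρ ⊢s)
  ⊢apply ⊢ρ (I∧⁺ ⊢t ⊢s)     = I∧⁺ (⊢apply ⊢ρ ⊢t) (⊢apply ⊢ρ ⊢s)
  ⊢apply ⊢ρ (I∨⁻ ⊢t ⊢s)     = I∨⁻ (⊢apply ⊢ρ ⊢t) (⊢apply ⊢ρ ⊢s)
  ⊢apply ⊢ρ (E∧⁺ i ⊢t)      = E∧⁺ i (⊢apply ⊢ρ ⊢t)
  ⊢apply ⊢ρ (E∨⁻ i ⊢t)      = E∨⁻ i (⊢apply ⊢ρ ⊢t)
  ⊢apply ⊢ρ (I∨⁺ i ⊢t)      = I∨⁺ i (⊢apply ⊢ρ ⊢t)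
  ⊢apply ⊢ρ (I∧⁻ i ⊢t)      = I∧⁻ i (⊢apply ⊢ρ ⊢t)
  ⊢apply ⊢ρ (E∨⁺ ⊢t ⊢s ⊢u)  =
    E∨⁺ (⊢apply ⊢ρ ⊢t) (⊢apply (⊢↑ _ ⊢ρ) ⊢s) (⊢apply (⊢↑ _ ⊢ρ) ⊢u)
  ⊢apply ⊢ρ (E∧⁻ ⊢t ⊢s ⊢u)  =
    E∧⁻ (⊢apply ⊢ρ ⊢t) (⊢apply (⊢↑ _ ⊢ρ) ⊢s) (⊢apply (⊢↑ _ ⊢ρ) ⊢u)
  ⊢apply ⊢ρ (I¬⁺ ⊢t)        = I¬⁺ (⊢apply ⊢ρ ⊢t)
  ⊢apply ⊢ρ (I¬⁻ ⊢t)        = I¬⁻ (⊢apply ⊢ρ ⊢t)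
  ⊢apply ⊢ρ (E¬⁺ ⊢t)        = E¬⁺ (⊢apply ⊢ρ ⊢t)
  ⊢apply ⊢ρ (E¬⁻ ⊢t)        = E¬⁻ (⊢apply ⊢ρ ⊢t)
  ⊢apply ⊢ρ (IC⁺ ⊢t)        = IC⁺ (⊢apply (⊢↑ _ ⊢ρ) ⊢t)
  ⊢apply ⊢ρ (IC⁻ ⊢t)        = IC⁻ (⊢apply (⊢↑ _ ⊢ρ) ⊢t)
  ⊢apply ⊢ρ (EC⁺ ⊢t ⊢s)     = EC⁺ (⊢apply ⊢ρ ⊢t) (⊢apply ⊢ρ ⊢s)
  ⊢apply ⊢ρ (EC⁻ ⊢t ⊢s)     = EC⁻ (⊢apply ⊢ρ ⊢t) (⊢apply ⊢ρ ⊢s)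

typedVarLift : TypedLift (TermSubst.varLift termSubst)
typedVarLift = record
  { _⊢ₜ_∶_    = λ Γ x P → Γ [ x ]= P
  ; ⊢var-zero = here
  ; ⊢weaken   = there
  ; ⊢lift     = ax
  }

⊢wk : ∀ {n Q} {Γ : Context n} → TypedSub typedVarLift Γ (Q ∷ Γ) VarSubst.wk
⊢wk {Q = Q} {Γ} {x} x∈ =
  subst ((Q ∷ Γ) [_]= _) (sym (VarLemmas.lookup-wk x)) (there x∈)

typedTermLift : TypedLift (TermSubst.termLift termSubst)
typedTermLift = record
  { _⊢ₜ_∶_    = _⊢_∶_
  ; ⊢var-zero = ax here
  ; ⊢weaken   = ⊢apply typedVarLift ⊢wk
  ; ⊢lift     = λ ⊢t → ⊢t
  }

-- Boolean semantics and openness of typed explosions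

-- Any valuation of the atoms would serve; the constantly true one is fixed.
⟦_⟧ : Pure → Bool
⟦ atom _ ⟧ = true
⟦ A ∧ B ⟧  = ⟦ A ⟧ Bool.∧ ⟦ B ⟧
⟦ A ∨ B ⟧  = ⟦ A ⟧ Bool.∨ ⟦ B ⟧
⟦ ¬ A ⟧    = Bool.not ⟦ A ⟧

⟦_⟧ˢ : Sign → Bool
⟦ + ⟧ˢ = true
⟦ - ⟧ˢ = false

Holds : Type → Set
Holds (A ^ strong σ)    = ⟦ A ⟧ ≡ ⟦ σ ⟧ˢ
Holds (A ^ classical σ) = ⟦ A ⟧ ≡ ⟦ σ ⟧ˢ

true≢false : ∀ {b} → b ≡ true → b ≡ false → ⊥
true≢false refl ()

Holds-~ : ∀ P → Holds P → Holds (P ~) → ⊥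
Holds-~ (A ⁺) p q = true≢false p q
Holds-~ (A ⁻) p q = true≢false q p
Holds-~ (A ⊕) p q = true≢false p q
Holds-~ (A ⊖) p q = true≢false q p

-- Restricting to the variables that occur in `t` makes this vacuous for a term without free
-- variables, even in a nonempty context.
SatisfiesFV : ∀ {n} → Context n → Term n → Set
SatisfiesFV Γ t = ∀ {x} → x ∈FV t → Holds (lookup Γ x)

extend : ∀ {n} {Γ : Context n} {t P} → Holds P →
         (∀ {x} → suc x ∈FV t → Holds (lookup Γ x)) → SatisfiesFV (P ∷ Γ) t
extend p γ {zero}  _  = p
extend p γ {suc x} x∈ = γ x∈

soundness : ∀ {n} {Γ : Context n} {t P} → Γ ⊢ t ∶ P → SatisfiesFV Γ t → Holds P
soundness (ax x∈) γ = subst Holds ([]=⇒lookup x∈) (γ refl)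
soundness (abs {P = P} _ ⊢t ⊢s) γ =
  ⊥-elim (Holds-~ P (soundness ⊢t (γ ∘ inj₁)) (soundness ⊢s (γ ∘ inj₂)))
soundness (I∧⁺ ⊢t ⊢s) γ = cong₂ Bool._∧_ (soundness ⊢t (γ ∘ inj₁)) (soundness ⊢s (γ ∘ inj₂))
soundness (I∨⁻ ⊢t ⊢s) γ = cong₂ Bool._∨_ (soundness ⊢t (γ ∘ inj₁)) (soundness ⊢s (γ ∘ inj₂))
soundness (E∧⁺ {A₁ = A} {B} i ⊢t) γ with ⟦ A ⟧ in a | ⟦ B ⟧ in b | soundness ⊢t γ | i
... | true | true | _ | zero     = a
... | true | true | _ | suc zero = b
soundness (E∨⁻ {A₁ = A} {B} i ⊢t) γ with ⟦ A ⟧ in a | ⟦ B ⟧ in b | soundness ⊢t γ | i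
... | false | false | _ | zero     = a
... | false | false | _ | suc zero = b
soundness (I∨⁺ zero ⊢t) γ rewrite soundness ⊢t γ = refl
-- `Bool.∨` computes on its left argument, so a true right disjunct takes effect only after a split
-- on `⟦ A ⟧`.
soundness (I∨⁺ {A₁ = A} (suc zero) ⊢t) γ rewrite soundness ⊢t γ with ⟦ A ⟧
... | true  = refl
... | false = refl
soundness (I∧⁻ zero ⊢t) γ rewrite soundness ⊢t γ = refl
soundness (I∧⁻ {A₁ = A} (suc zero) ⊢t) γ rewrite soundness ⊢t γ with ⟦ A ⟧
... | true  = refl
... | false = refl
soundness (E∨⁺ {s = s} {u} {A} {B} ⊢t ⊢s ⊢u) γ with ⟦ A ⟧ in a | soundness ⊢t (γ ∘ inj₁)
... | true  | _ = soundness ⊢s (extend {t = s} a (γ ∘ inj₂ ∘ inj₁))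
... | false | b = soundness ⊢u (extend {t = u} b (γ ∘ inj₂ ∘ inj₂))
soundness (E∧⁻ {s = s} {u} {A} {B} ⊢t ⊢s ⊢u) γ with ⟦ A ⟧ in a | soundness ⊢t (γ ∘ inj₁)
... | false | _ = soundness ⊢s (extend {t = s} a (γ ∘ inj₂ ∘ inj₁))
... | true  | b = soundness ⊢u (extend {t = u} b (γ ∘ inj₂ ∘ inj₂))
soundness (I¬⁺ ⊢t) γ = cong Bool.not (soundness ⊢t γ)
soundness (I¬⁻ ⊢t) γ = cong Bool.not (soundness ⊢t γ)
soundness (E¬⁺ {A = A} ⊢t) γ with ⟦ A ⟧ | soundness ⊢t γ
... | false | _ = refl
soundness (E¬⁻ {A = A} ⊢t) γ with ⟦ A ⟧ | soundness ⊢t γ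
... | true | _ = refl
-- Reductio: were `A` false, the bound assumption `A ⊖` would hold, and the body would make `A`
-- true.
soundness (IC⁺ {t} {A} ⊢t) γ with ⟦ A ⟧ in a
... | true  = refl
... | false = trans (sym a) (soundness ⊢t (extend {t = t} a γ))
soundness (IC⁻ {t} {A} ⊢t) γ with ⟦ A ⟧ in a
... | false = refl
... | true  = trans (sym a) (soundness ⊢t (extend {t = t} a γ))
soundness (EC⁺ ⊢t ⊢s) γ = soundness ⊢t (γ ∘ inj₁)
soundness (EC⁻ ⊢t ⊢s) γ = soundness ⊢t (γ ∘ inj₁)

-- The semantics only refutes closedness, while `Open` asks for a variable. Deciding occurrence and
-- searching the finite scope provides one in `explosion-open`.
_∈FV?_ : ∀ {n} (x : Fin n) t → Dec (x ∈FV t)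
x ∈FV? var y         = x ≟ y
x ∈FV? (t ▶◀[ P ] s) = x ∈FV? t ⊎-dec x ∈FV? s
x ∈FV? pair σ t s    = x ∈FV? t ⊎-dec x ∈FV? s
x ∈FV? π σ i t       = x ∈FV? t
x ∈FV? inj σ i t     = x ∈FV? t
x ∈FV? δ σ t P s Q u = x ∈FV? t ⊎-dec (suc x ∈FV? s ⊎-dec suc x ∈FV? u)
x ∈FV? ν σ t         = x ∈FV? t
x ∈FV? μ σ t         = x ∈FV? t
x ∈FV? IC σ P t      = suc x ∈FV? t
x ∈FV? (t •[ σ ] s)  = x ∈FV? t ⊎-dec x ∈FV? s

closed-Holds : ∀ {n} {Γ : Context n} {t P} → (Open t → ⊥) → Γ ⊢ t ∶ P → Holds P
closed-Holds closed ⊢t = soundness ⊢t (λ x∈ → ⊥-elim (closed (_ , x∈)))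

explosion-not-closed : ∀ {n} {Γ : Context n} {t P} →
                       Explosion t → Γ ⊢ t ∶ P → (Open t → ⊥) → ⊥
explosion-not-closed (absurdity _ _ _) (abs {P = P} _ ⊢t ⊢s) closed =
  Holds-~ P (closed-Holds (λ (x , x∈) → closed (x , inj₁ x∈)) ⊢t)
            (closed-Holds (λ (x , x∈) → closed (x , inj₂ x∈)) ⊢s)
explosion-not-closed (application _ _ _) (EC⁺ {A = A} ⊢t ⊢s) closed =
  Holds-~ (A ⊕) (closed-Holds (λ (x , x∈) → closed (x , inj₁ x∈)) ⊢t)
                (closed-Holds (λ (x , x∈) → closed (x , inj₂ x∈)) ⊢s)
explosion-not-closed (application _ _ _) (EC⁻ {A = A} ⊢t ⊢s) closed =
  Holds-~ (A ⊖) (closed-Holds (λ (x , x∈) → closed (x , inj₁ x∈)) ⊢t)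
                (closed-Holds (λ (x , x∈) → closed (x , inj₂ x∈)) ⊢s)

explosion-open : ∀ {n} {Γ : Context n} {t P} → Explosion t → Γ ⊢ t ∶ P → Open t
explosion-open {t = t} e ⊢t with any? (_∈FV? t)
... | yes open-t = open-t
... | no  closed = ⊥-elim (explosion-not-closed e ⊢t closed)

-- Evaluation

StuckStrong : ∀ {n} → Term n → Set
StuckStrong t = ∃[ K ] ∃[ t′ ] (t ⟶* K K⟨ t′ ⟩ × Explosion t′ × Open t′)

StuckClassical : ∀ {n} → Term n → Set
StuckClassical t =
  ∃[ E ] ∃[ t′ ] (t ⟶* E E⟨ t′ ⟩ × (Variable t′ ⊎ (Explosion t′ × Open t′)))

ClassicalOutcome : ∀ {n} → Term n → Set
ClassicalOutcome t = (∃[ σ ] ∃[ Q ] ∃[ t′ ] (t ⟶* IC σ Q t′)) ⊎ StuckClassical t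

infix 4 _⊩_∶_

data Value {n} (Γ : Context n) : Type → Term n → Set

Outcome : ∀ {n} → Context n → Type → Term n → Set
Outcome Γ (A ^ classical σ) t = ClassicalOutcome t
Outcome Γ (A ^ strong σ)    t = (∃[ v ] (t ⟶* v × Value Γ (A ^ strong σ) v)) ⊎ StuckStrong t

-- Typing is kept next to the outcome because components of values get substituted for bound
-- variables, and explosions in the resulting instances are shown open through their typing.
_⊩_∶_ : ∀ {n} → Context n → Term n → Type → Set
Γ ⊩ t ∶ P = Γ ⊢ t ∶ P × Outcome Γ P t

data Value Γ where
  pair⁺ : ∀ {t s A B} → Γ ⊩ t ∶ A ⊕ → Γ ⊩ s ∶ B ⊕ → Value Γ (A ∧ B ⁺) (pair + t s)
  pair⁻ : ∀ {t s A B} → Γ ⊩ t ∶ A ⊖ → Γ ⊩ s ∶ B ⊖ → Value Γ (A ∨ B ⁻) (pair - t s)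
  inj⁺  : ∀ {t A₁ A₂} i → Γ ⊩ t ∶ pick i A₁ A₂ ⊕ → Value Γ (A₁ ∨ A₂ ⁺) (inj + i t)
  inj⁻  : ∀ {t A₁ A₂} i → Γ ⊩ t ∶ pick i A₁ A₂ ⊖ → Value Γ (A₁ ∧ A₂ ⁻) (inj - i t)
  ν⁺    : ∀ {t A} → Γ ⊩ t ∶ A ⊖ → Value Γ (¬ A ⁺) (ν + t)
  ν⁻    : ∀ {t A} → Γ ⊩ t ∶ A ⊕ → Value Γ (¬ A ⁻) (ν - t)

value-canonical : ∀ {n} {Γ : Context n} {P v} → Value Γ P v → Canonical v
value-canonical (pair⁺ _ _) = pair _ _ _
value-canonical (pair⁻ _ _) = pair _ _ _
value-canonical (inj⁺ _ _)  = inj _ _ _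
value-canonical (inj⁻ _ _)  = inj _ _ _
value-canonical (ν⁺ _)      = ν _ _
value-canonical (ν⁻ _)      = ν _ _

classical-expand : ∀ {n} {t t′ : Term n} → t ⟶* t′ → ClassicalOutcome t′ → ClassicalOutcome t
classical-expand r (inj₁ (σ , Q , t , r′)) = inj₁ (σ , Q , t , r ◅◅ r′)
classical-expand r (inj₂ (E , e , r′ , w)) = inj₂ (E , e , r ◅◅ r′ , w)

outcome-expand : ∀ {n} {Γ : Context n} P {t t′} → t ⟶* t′ → Outcome Γ P t′ → Outcome Γ P t
outcome-expand (A ^ strong _)    r (inj₁ (v , r′ , w))     = inj₁ (v , r ◅◅ r′ , w)
outcome-expand (A ^ strong _)    r (inj₂ (K , e , r′ , w)) = inj₂ (K , e , r ◅◅ r′ , w)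
outcome-expand (A ^ classical _) r o                       = classical-expand r o

explosion-outcome : ∀ {n} {Γ : Context n} P {t} → Explosion t → Γ ⊢ t ∶ P → Outcome Γ P t
explosion-outcome (A ^ strong _)    e ⊢t = inj₂ (□ , _ , ε , e , explosion-open e ⊢t)
explosion-outcome (A ^ classical _) e ⊢t = inj₂ (□ , _ , ε , inj₂ (e , explosion-open e ⊢t))

-- Every case-context is an eliminative context. This is used when a stuck scrutinee, always of
-- strong type, lies under an eliminator whose result is classical.
stuckStrong⇒stuckClassical : ∀ {n} {t : Term n} → StuckStrong t → StuckClassical t
stuckStrong⇒stuckClassical (K , e , r , w) =
  toElim K , e , subst (_ ⟶*_) (toElim-⟨⟩ K) r , inj₂ w
  where
  toElim : ∀ {n} → CaseContext n → ElimContext n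
  toElim □               = □
  toElim (δ σ K P s Q u) = δ σ (toElim K) P s Q u

  toElim-⟨⟩ : ∀ {n} (K : CaseContext n) {t} → K K⟨ t ⟩ ≡ toElim K E⟨ t ⟩
  toElim-⟨⟩ □               = refl
  toElim-⟨⟩ (δ σ K P s Q u) = cong (λ t → δ σ t P s Q u) (toElim-⟨⟩ K)

π-stuck : ∀ {n σ i} {t : Term n} → StuckStrong t → ClassicalOutcome (π σ i t)
π-stuck {σ = σ} {i} st with E , e , r , w ← stuckStrong⇒stuckClassical st =
  inj₂ (π σ i E , e , gmap (π σ i) ξ-π r , w)

μ-stuck : ∀ {n σ} {t : Term n} → StuckStrong t → ClassicalOutcome (μ σ t)
μ-stuck {σ = σ} st with E , e , r , w ← stuckStrong⇒stuckClassical st =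
  inj₂ (μ σ E , e , gmap (μ σ) ξ-μ r , w)

-- Unlike `π` and `μ`, whose results are classical, `δ` may have a result of either mode. A strong
-- result keeps the case-context, which is why the case-contexts need only frames for `δ`.
δ-stuck : ∀ {n} {Γ : Context n} R {σ t P s Q u} →
          StuckStrong t → Outcome Γ R (δ σ t P s Q u)
δ-stuck (A ^ strong _) {σ} {P = P} {s} {Q} {u} (K , e , r , w) =
  inj₂ (δ σ K P s Q u , e , gmap (λ t → δ σ t P s Q u) ξ-δ₀ r , w)
δ-stuck (A ^ classical _) {σ} {P = P} {s} {Q} {u} st
  with E , e , r , w ← stuckStrong⇒stuckClassical st =
  inj₂ (δ σ E P s Q u , e , gmap (λ t → δ σ t P s Q u) ξ-δ₀ r , w)

-- Reducible substitutions and the induction on typing derivations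

ReducibleSub : ∀ {m n} → Context m → Context n → Sub Term m n → Set
ReducibleSub Γ Δ ρ = ∀ {x P} → Γ [ x ]= P → Δ ⊩ lookup ρ x ∶ P

reducible-∷ : ∀ {m n P t} {Γ : Context m} {Δ : Context n} {ρ} →
              Δ ⊩ t ∶ P → ReducibleSub Γ Δ ρ → ReducibleSub (P ∷ Γ) Δ (t ∷ ρ)
reducible-∷ ⊩t ⊩ρ here       = ⊩t
reducible-∷ ⊩t ⊩ρ (there x∈) = ⊩ρ x∈

-- Classicality of `Γ` enters here: a variable of classical type is stuck in the empty eliminative
-- context, whereas a variable of strong type would have no outcome.
reducible-id : ∀ {n} {Γ : Context n} → ClassicalContext Γ → ReducibleSub Γ Γ id
reducible-id cl {x} x∈ rewrite lookup-id x with subst ClassicalType ([]=⇒lookup x∈) (lookup⁺ cl x)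
... | classical _ = ax x∈ , inj₂ (□ , var x , ε , inj₁ (var x))

⊢instance : ∀ {m n t P} {Γ : Context m} {Δ : Context n} {ρ} →
            ReducibleSub Γ Δ ρ → Γ ⊢ t ∶ P → Δ ⊢ t / ρ ∶ P
⊢instance ⊩ρ = ⊢apply typedTermLift (proj₁ ∘ ⊩ρ)

π-outcome : ∀ {n} {Γ : Context n} {t t₁ t₂ P₁ P₂} σ i → t ⟶* pair σ t₁ t₂ →
            Γ ⊢ t₁ ∶ P₁ × ClassicalOutcome t₁ → Γ ⊢ t₂ ∶ P₂ × ClassicalOutcome t₂ →
            ClassicalOutcome (π σ i t)
π-outcome σ zero       r (_ , o) _ = classical-expand (gmap (π σ zero) ξ-π r ◅◅ β-π ◅ ε) o
π-outcome σ (suc zero) r _ (_ , o) = classical-expand (gmap (π σ (suc zero)) ξ-π r ◅◅ β-π ◅ ε) o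

-- Outcomes are closed under expansion, so the contractum decides; by `/-↑-sub` it is the chosen
-- branch under `t′ ∷ ρ`.
δ-outcome : ∀ {m n} {Δ : Context n} {ρ : Sub Term m n} {σ t t′ Q₁ Q₂} P i s₁ s₂ →
            t ⟶* inj σ i t′ → Outcome Δ P (pick i s₁ s₂ / (t′ ∷ ρ)) →
            Outcome Δ P (δ σ t Q₁ (s₁ / ρ ↑) Q₂ (s₂ / ρ ↑))
δ-outcome {ρ = ρ} {t′ = t′} P zero s₁ s₂ r o =
  outcome-expand P (gmap _ ξ-δ₀ r ◅◅ β-δ ◅ ε) (subst (Outcome _ P) (sym (/-↑-sub s₁ ρ t′)) o)
δ-outcome {ρ = ρ} {t′ = t′} P (suc zero) s₁ s₂ r o =
  outcome-expand P (gmap _ ξ-δ₀ r ◅◅ β-δ ◅ ε) (subst (Outcome _ P) (sym (/-↑-sub s₂ ρ t′)) o)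

mutual
  reducible : ∀ {m n t P} {Γ : Context m} {Δ : Context n} {ρ} →
              ReducibleSub Γ Δ ρ → Γ ⊢ t ∶ P → Δ ⊩ t / ρ ∶ P
  reducible ⊩ρ ⊢t = ⊢instance ⊩ρ ⊢t , outcome ⊩ρ ⊢t

  outcome : ∀ {m n t P} {Γ : Context m} {Δ : Context n} {ρ} →
            ReducibleSub Γ Δ ρ → Γ ⊢ t ∶ P → Outcome Δ P (t / ρ)
  outcome ⊩ρ (ax x∈) = proj₂ (⊩ρ x∈)
  outcome ⊩ρ ⊢t@(abs {Q = Q} _ _ _) =
    explosion-outcome Q (absurdity _ _ _) (⊢instance ⊩ρ ⊢t)
  outcome ⊩ρ (I∧⁺ ⊢t ⊢s) = inj₁ (_ , ε , pair⁺ (reducible ⊩ρ ⊢t) (reducible ⊩ρ ⊢s))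
  outcome ⊩ρ (I∨⁻ ⊢t ⊢s) = inj₁ (_ , ε , pair⁻ (reducible ⊩ρ ⊢t) (reducible ⊩ρ ⊢s))
  outcome ⊩ρ (E∧⁺ i ⊢t) with outcome ⊩ρ ⊢t
  ... | inj₁ (_ , r , pair⁺ ⊩t ⊩s) = π-outcome + i r ⊩t ⊩s
  ... | inj₂ st                    = π-stuck st
  outcome ⊩ρ (E∨⁻ i ⊢t) with outcome ⊩ρ ⊢t
  ... | inj₁ (_ , r , pair⁻ ⊩t ⊩s) = π-outcome - i r ⊩t ⊩s
  ... | inj₂ st                    = π-stuck st
  outcome ⊩ρ (I∨⁺ i ⊢t) = inj₁ (_ , ε , inj⁺ i (reducible ⊩ρ ⊢t))
  outcome ⊩ρ (I∧⁻ i ⊢t) = inj₁ (_ , ε , inj⁻ i (reducible ⊩ρ ⊢t))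
  outcome ⊩ρ (E∨⁺ {s = s} {u} {P = P} ⊢t ⊢s ⊢u) with outcome ⊩ρ ⊢t
  -- The outcome recorded for the injected term makes the extended substitution reducible. The
  -- recursive call is on the subderivation `⊢s`, whatever the size of the instance.
  ... | inj₁ (_ , r , inj⁺ zero ⊩r)       =
    δ-outcome P zero s u r (outcome (reducible-∷ ⊩r ⊩ρ) ⊢s)
  ... | inj₁ (_ , r , inj⁺ (suc zero) ⊩r) =
    δ-outcome P (suc zero) s u r (outcome (reducible-∷ ⊩r ⊩ρ) ⊢u)
  ... | inj₂ st                           = δ-stuck P st
  outcome ⊩ρ (E∧⁻ {s = s} {u} {P = P} ⊢t ⊢s ⊢u) with outcome ⊩ρ ⊢t
  ... | inj₁ (_ , r , inj⁻ zero ⊩r)       =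
    δ-outcome P zero s u r (outcome (reducible-∷ ⊩r ⊩ρ) ⊢s)
  ... | inj₁ (_ , r , inj⁻ (suc zero) ⊩r) =
    δ-outcome P (suc zero) s u r (outcome (reducible-∷ ⊩r ⊩ρ) ⊢u)
  ... | inj₂ st                           = δ-stuck P st
  outcome ⊩ρ (I¬⁺ ⊢t) = inj₁ (_ , ε , ν⁺ (reducible ⊩ρ ⊢t))
  outcome ⊩ρ (I¬⁻ ⊢t) = inj₁ (_ , ε , ν⁻ (reducible ⊩ρ ⊢t))
  outcome ⊩ρ (E¬⁺ ⊢t) with outcome ⊩ρ ⊢t
  ... | inj₁ (_ , r , ν⁺ (_ , o)) = classical-expand (gmap (μ +) ξ-μ r ◅◅ β-μ ◅ ε) o
  ... | inj₂ st                   = μ-stuck st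
  outcome ⊩ρ (E¬⁻ ⊢t) with outcome ⊩ρ ⊢t
  ... | inj₁ (_ , r , ν⁻ (_ , o)) = classical-expand (gmap (μ -) ξ-μ r ◅◅ β-μ ◅ ε) o
  ... | inj₂ st                   = μ-stuck st
  -- Already an outcome at a classical type; the body stays unevaluated.
  outcome ⊩ρ (IC⁺ ⊢t) = inj₁ (_ , _ , _ , ε)
  outcome ⊩ρ (IC⁻ ⊢t) = inj₁ (_ , _ , _ , ε)
  outcome ⊩ρ ⊢t@(EC⁺ _ _) = explosion-outcome (_ ⁺) (application _ _ _) (⊢instance ⊩ρ ⊢t)
  outcome ⊩ρ ⊢t@(EC⁻ _ _) = explosion-outcome (_ ⁻) (application _ _ _) (⊢instance ⊩ρ ⊢t)

-- Canonicity, from the identity substitution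

typed-outcome : ∀ {n t P} {Γ : Context n} → ClassicalContext Γ → Γ ⊢ t ∶ P → Outcome Γ P t
typed-outcome {t = t} cl ⊢t =
  subst (Outcome _ _) (id-vanishes t) (outcome (reducible-id cl) ⊢t)

theorem35 : (∀ {t P} → [] ⊢ t ∶ P → ∃[ t′ ] (t ⟶* t′ × Canonical t′))
    ×
    (∀ {n} {Γ : Context n} {t P} →
    ClassicalContext Γ → StrongType P → Γ ⊢ t ∶ P →
    (∃[ t′ ] (t ⟶* t′ × Canonical t′))
    ⊎
    (∃[ K ] ∃[ t′ ] (t ⟶* K K⟨ t′ ⟩ × Explosion t′ × Open t′)))
    ×
    (∀ {n} {Γ : Context n} {t P} →
    ClassicalContext Γ → ClassicalType P → Γ ⊢ t ∶ P →
    (∃[ σ ] ∃[ Q ] ∃[ t′ ] (t ⟶* IC σ Q t′))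
    ⊎
    (∃[ E ] ∃[ t′ ] (t ⟶* E E⟨ t′ ⟩ × (Variable t′ ⊎ (Explosion t′ × Open t′)))))
theorem35 = closed , strong-case , classical-case
  where
  strong-case : ∀ {n} {Γ : Context n} {t P} →
                ClassicalContext Γ → StrongType P → Γ ⊢ t ∶ P →
                (∃[ t′ ] (t ⟶* t′ × Canonical t′)) ⊎ StuckStrong t
  strong-case cl (strong _) ⊢t with typed-outcome cl ⊢t
  ... | inj₁ (v , r , w) = inj₁ (v , r , value-canonical w)
  ... | inj₂ st          = inj₂ st

  classical-case : ∀ {n} {Γ : Context n} {t P} →
                   ClassicalContext Γ → ClassicalType P → Γ ⊢ t ∶ P → ClassicalOutcome t
  classical-case cl (classical _) ⊢t = typed-outcome cl ⊢t

  closed : ∀ {t P} → [] ⊢ t ∶ P → ∃[ t′ ] (t ⟶* t′ × Canonical t′)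
  closed {P = A ^ strong σ} ⊢t with strong-case [] (strong σ) ⊢t
  ... | inj₁ c                          = c
  -- Being open would give an element of `Fin 0`. The last two clauses below exclude a stuck
  -- variable and a stuck open explosion in the same way.
  ... | inj₂ (_ , _ , _ , _ , () , _)
  closed {P = A ^ classical σ} ⊢t with typed-outcome [] ⊢t
  ... | inj₁ (σ , Q , t , r)            = IC σ Q t , r , IC σ Q t
  ... | inj₂ (_ , _ , _ , inj₁ (var ()))
  ... | inj₂ (_ , _ , _ , inj₂ (_ , () , _))
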